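{- Let $n$ and $k$ be odd integers with $k\ge 3$ and $n>2k+1$. Then there is a homomorphism $\mathrm{Pet}(n,k)\to C_n^{\,k}$.
   Context: For integers $n,k$ with $2<2k\le n$, the generalized Petersen graph $\mathrm{Pet}(n,k)$ has vertex set $\{u_0,\dots,u_{n-1}\}\cup\{v_0,\dots,v_{n-1}\}$ and edge set $\{u_iu_{i+1}\}\cup\{u_iv_i\}\cup\{v_iv_{i+k}\}$, indices modulo $n$. $C_n$ is the cycle of length $n$. For a graph $G$ and positive integer $m$, the power graph $G^m$ has vertex set $V(G)$, two distinct vertices being adjacent iff there is a walk of length exactly $m$ between them in $G$. A homomorphism $G\to H$ is a map $V(G)\to V(H)$ sending edges to edges. -}

module Defs where

open import Data.Fin.Base using (Fin; toℕ)
open import Data.Fin.Properties using (toℕ<n; toℕ-fromℕ<; nonZeroIndex)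
open import Data.Nat.Base
open import Data.Nat.DivMod
  using (_mod_; _%_; m%n<n; m<n⇒m%n≡m; m≤n⇒[n∸m]%m≡n%m)
open import Data.Nat.Properties
open import Data.Product.Base using (_×_; _,_)
open import Data.Sum.Base using (inj₁; inj₂)
open import Function.Base using (case_of_)
open import Level using (0ℓ)
open import Relation.Binary.Construct.Closure.Symmetric
  using (SymClosure; fwd; bwd; symmetric)
open import Relation.Binary.Core using (Rel; _Preserves_⟶_)
open import Relation.Binary.Definitions using (Symmetric; Irreflexive)
open import Relation.Binary.PropositionalEquality
  using (_≡_; _≢_; refl; sym; trans; cong; ≢-sym)

record Graph : Set₁ where
  field
    Vertex : Set
    Adj    : Rel Vertex 0ℓ
    adj-sym    : Symmetric Adj
    adj-irrefl : Irreflexive _≡_ Adj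

open Graph public using (Vertex; Adj)

record Hom (G H : Graph) : Set where
  field
    map : Vertex G → Vertex H
    preserves-adj : map Preserves Adj G ⟶ Adj H

data Walk (G : Graph) : ℕ → Vertex G → Vertex G → Set where
  []  : ∀ {x} → Walk G 0 x x
  _∷_ : ∀ {m x y z} → Adj G x y → Walk G m y z → Walk G (suc m) x z

infixr 5 _∷_

private
  snoc : ∀ {G m x y z} → Walk G m x y → Adj G y z → Walk G (suc m) x z
  snoc []      f = f ∷ []
  snoc (e ∷ w) f = e ∷ snoc w f

  reverse : ∀ {G m x y} → Walk G m x y → Walk G m y x
  reverse []              = []
  reverse {G = G} (e ∷ w) = snoc (reverse w) (Graph.adj-sym G e)

Power : Graph → ℕ → Graph
Power G m = record
  { Vertex     = Vertex G
  ; Adj        = λ x y → x ≢ y × Walk G m x y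
  ; adj-sym    = λ { (x≢y , w) → ≢-sym x≢y , reverse w }
  ; adj-irrefl = λ { x≡y (x≢y , _) → x≢y x≡y }
  }

-- Addition of indices modulo n, which is nonzero because Fin n is inhabited by i.
_⊕_ : ∀ {n} → Fin n → ℕ → Fin n
_⊕_ {n} i d = _mod_ (toℕ i + d) n {{nonZeroIndex i}}

infixl 6 _⊕_

private
  shift% : ∀ a d n .{{_ : NonZero n}} → a < n → 0 < d → d < n → a ≢ (a + d) % n
  shift% a d n a<n 0<d d<n eq = case <-≤-connex (a + d) n of λ where
    (inj₁ a+d<n) → <⇒≢ (m<m+n a 0<d) (trans eq (m<n⇒m%n≡m a+d<n))
    (inj₂ n≤a+d) →
      let r<a : a + d ∸ n < a
          r<a = +-cancelʳ-< n (a + d ∸ n) a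
                  (≤-<-trans (≤-reflexive (m∸n+n≡m n≤a+d)) (+-monoʳ-< a d<n))
      in <⇒≢ r<a (sym (trans eq (trans (sym (m≤n⇒[n∸m]%m≡n%m n≤a+d))
                                       (m<n⇒m%n≡m (<-trans r<a a<n)))))

  i≢i⊕d : ∀ {n} (i : Fin n) {d} → 0 < d → d < n → i ≢ i ⊕ d
  i≢i⊕d {n} i {d} 0<d d<n eq =
    shift% (toℕ i) d n (toℕ<n i) 0<d d<n
      (trans (cong toℕ eq) (toℕ-fromℕ< (m%n<n (toℕ i + d) n)))
    where instance _ = nonZeroIndex i

data CycleEdge (n : ℕ) : Rel (Fin n) 0ℓ where
  edge : ∀ i → CycleEdge n i (i ⊕ 1)

Cycle : (n : ℕ) → 3 ≤ n → Graph
Cycle n 3≤n = record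
  { Vertex     = Fin n
  ; Adj        = SymClosure (CycleEdge n)
  ; adj-sym    = symmetric (CycleEdge n)
  ; adj-irrefl = λ { eq (fwd e) → loopless eq e ; eq (bwd e) → loopless (sym eq) e }
  }
  where
  loopless : Irreflexive _≡_ (CycleEdge n)
  loopless eq (edge i) = i≢i⊕d i z<s (<-≤-trans (s<s z<s) (≤-trans (n≤1+n 2) 3≤n)) eq

data PetVertex (n : ℕ) : Set where
  u v : Fin n → PetVertex n

data PetEdge (n k : ℕ) : Rel (PetVertex n) 0ℓ where
  outer : ∀ i → PetEdge n k (u i) (u (i ⊕ 1))
  spoke : ∀ i → PetEdge n k (u i) (v i)
  inner : ∀ i → PetEdge n k (v i) (v (i ⊕ k))

Pet : (n k : ℕ) → 2 < 2 * k → 2 * k ≤ n → Graph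
Pet n k 2<2k 2k≤n = record
  { Vertex     = PetVertex n
  ; Adj        = SymClosure (PetEdge n k)
  ; adj-sym    = symmetric (PetEdge n k)
  ; adj-irrefl = λ { eq (fwd e) → loopless eq e ; eq (bwd e) → loopless (sym eq) e }
  }
  where
  1<k : 1 < k
  1<k = *-cancelˡ-< 2 1 k 2<2k

  0<k : 0 < k
  0<k = <-trans z<s 1<k

  k<n : k < n
  k<n = <-≤-trans (m<m+n k (<-≤-trans 0<k (m≤m+n k 0))) 2k≤n

  index : PetVertex n → Fin n
  index (u i) = i
  index (v i) = i

  loopless : Irreflexive _≡_ (PetEdge n k)
  loopless eq (outer i) = i≢i⊕d i z<s (<-trans 1<k k<n) (cong index eq)
  loopless () (spoke i)
  loopless eq (inner i) = i≢i⊕d i 0<k k<n (cong index eq)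

k≥3⇒2<2k : ∀ k → k ≥ 3 → 2 < 2 * k
k≥3⇒2<2k k k≥3 = ≤-trans k≥3 (m≤m+n k (k + 0))

n>2k+1⇒2k≤n : ∀ n k → n > 2 * k + 1 → 2 * k ≤ n
n>2k+1⇒2k≤n n k n>2k+1 = ≤-trans (m≤m+n (2 * k) 1) (<⇒≤ n>2k+1)

n>2k+1⇒n≥3 : ∀ n k → k ≥ 3 → n > 2 * k + 1 → 3 ≤ n
n>2k+1⇒n≥3 n k k≥3 n>2k+1 = ≤-trans (k≥3⇒2<2k k k≥3) (n>2k+1⇒2k≤n n k n>2k+1)

{-# OPTIONS --safe #-}

-- Send u_i to i and v_i to i + 1.  Edges of Pet(n,k) then go to pairs at distance 1
-- or k on the cycle.  Pairs at distance k are joined by going straight; adjacent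
-- vertices are joined by a walk of odd length k that goes back and forth.
module Submission where

open import Defs
open import Data.Fin.Base using (Fin; toℕ)
open import Data.Fin.Properties
  using (toℕ<n; toℕ-fromℕ<; toℕ-injective; nonZeroIndex)
open import Data.Nat.Base using (ℕ; suc; _+_; _*_; _≥_; _>_; parity)
open import Data.Nat.DivMod using (_%_; m%n<n; m%n%n≡m%n; m<n⇒m%n≡m; %-distribˡ-+)
open import Data.Nat.Properties using (+-assoc; +-comm; +-identityʳ)
open import Data.Parity.Base using (1ℙ)
open import Data.Product.Base using (_,_)
open import Relation.Binary.Construct.Closure.Symmetric using (fwd; bwd)
open import Relation.Binary.PropositionalEquality
  using (_≡_; _≢_; sym; trans; cong; subst; module ≡-Reasoning)

toℕ-⊕ : ∀ {n} (i : Fin n) d → toℕ (i ⊕ d) ≡ _%_ (toℕ i + d) n {{nonZeroIndex i}}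
toℕ-⊕ {n} i d = toℕ-fromℕ< (m%n<n (toℕ i + d) n)
  where instance _ = nonZeroIndex i

⊕-identityʳ : ∀ {n} (i : Fin n) → i ⊕ 0 ≡ i
⊕-identityʳ {n} i = toℕ-injective (begin
  toℕ (i ⊕ 0)      ≡⟨ toℕ-⊕ i 0 ⟩
  (toℕ i + 0) % n  ≡⟨ cong (_% n) (+-identityʳ (toℕ i)) ⟩
  toℕ i % n        ≡⟨ m<n⇒m%n≡m (toℕ<n i) ⟩
  toℕ i            ∎)
  where
  open ≡-Reasoning
  instance _ = nonZeroIndex i

⊕-assoc : ∀ {n} (i : Fin n) a b → i ⊕ a ⊕ b ≡ i ⊕ (a + b)
⊕-assoc {n} i a b = toℕ-injective (begin
  toℕ (i ⊕ a ⊕ b)                    ≡⟨ toℕ-⊕ (i ⊕ a) b ⟩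
  (toℕ (i ⊕ a) + b) % n              ≡⟨ cong (λ r → (r + b) % n) (toℕ-⊕ i a) ⟩
  -- Distributing the outer reduction creates a doubled `% n`, which collapses; the distribution is
  -- then undone.
  ((toℕ i + a) % n + b) % n          ≡⟨ %-distribˡ-+ ((toℕ i + a) % n) b n ⟩
  ((toℕ i + a) % n % n + b % n) % n  ≡⟨ cong (λ r → (r + b % n) % n) (m%n%n≡m%n (toℕ i + a) n) ⟩
  ((toℕ i + a) % n + b % n) % n      ≡⟨ %-distribˡ-+ (toℕ i + a) b n ⟨
  (toℕ i + a + b) % n                ≡⟨ cong (_% n) (+-assoc (toℕ i) a b) ⟩
  (toℕ i + (a + b)) % n              ≡⟨ toℕ-⊕ i (a + b) ⟨
  toℕ (i ⊕ (a + b))                  ∎)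
  where
  open ≡-Reasoning
  instance _ = nonZeroIndex i

⊕-comm : ∀ {n} (i : Fin n) a b → i ⊕ a ⊕ b ≡ i ⊕ b ⊕ a
⊕-comm i a b =
  trans (⊕-assoc i a b) (trans (cong (i ⊕_) (+-comm a b)) (sym (⊕-assoc i b a)))

-- Crossing the edge and returning uses two steps and keeps the parity, so the length descends by
-- two to a single crossing.
adj⇒odd-walk : ∀ G {x y} m → parity m ≡ 1ℙ → Adj G x y → Walk G m x y
adj⇒odd-walk G 1             _   e = e ∷ []
adj⇒odd-walk G (suc (suc m)) odd e = e ∷ Graph.adj-sym G e ∷ adj⇒odd-walk G m odd e

straight-walk : ∀ {n} 3≤n m (i : Fin n) → Walk (Cycle n 3≤n) m i (i ⊕ m)
straight-walk 3≤n 0       i = subst (Walk _ 0 i) (sym (⊕-identityʳ i)) []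
straight-walk 3≤n (suc m) i =
  -- The walk built ends at `i ⊕ 1 ⊕ m`; reassociating gives `i ⊕ suc m`.
  subst (Walk _ (suc m) i) (⊕-assoc i 1 m) (fwd (edge i) ∷ straight-walk 3≤n m (i ⊕ 1))

pet→cycle^k : ∀ n k 2<2k 2k≤n 3≤n → parity k ≡ 1ℙ →
              Hom (Pet n k 2<2k 2k≤n) (Power (Cycle n 3≤n) k)
pet→cycle^k n k 2<2k 2k≤n 3≤n odd = record
  { map           = f
  ; preserves-adj = λ { (fwd e) → f-edge e ; (bwd e) → Graph.adj-sym Cᵏ (f-edge e) }
  }
  where
  C Cᵏ : Graph
  C  = Cycle n 3≤n
  Cᵏ = Power C k

  -- The shift on `v` keeps spokes from collapsing to a point; being uniform, it leaves inner edges
  -- at distance `k`.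
  f : PetVertex n → Fin n
  f (u i) = i
  f (v i) = i ⊕ 1

  step : ∀ i → Adj Cᵏ i (i ⊕ 1)
  -- Adjacency in a power also demands distinct endpoints, which looplessness of the cycle supplies.
  step i = (λ eq → Graph.adj-irrefl C eq (fwd (edge i)))
         , adj⇒odd-walk C k odd (fwd (edge i))

  -- Looplessness of the inner edges of Pet(n,k) says exactly that k ≢ 0 modulo n.
  i≢i⊕k : ∀ i → i ≢ i ⊕ k
  i≢i⊕k i eq = Graph.adj-irrefl (Pet n k 2<2k 2k≤n) (cong v eq) (fwd (inner i))

  leap : ∀ i → Adj Cᵏ i (i ⊕ k)
  leap i = i≢i⊕k i , straight-walk 3≤n k i

  f-edge : ∀ {x y} → PetEdge n k x y → Adj Cᵏ (f x) (f y)
  f-edge (outer i) = step i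
  f-edge (spoke i) = step i
  -- The image of `v (i ⊕ k)` is `i ⊕ k ⊕ 1`, while the leap from `i ⊕ 1` ends at `i ⊕ 1 ⊕ k`.
  f-edge (inner i) = subst (Adj Cᵏ (i ⊕ 1)) (⊕-comm i 1 k) (leap (i ⊕ 1))

theorem5 : (n k : ℕ) → parity n ≡ 1ℙ → parity k ≡ 1ℙ →
    (k≥3 : k ≥ 3) (n>2k+1 : n > 2 * k + 1) →
    Hom (Pet n k (k≥3⇒2<2k k k≥3) (n>2k+1⇒2k≤n n k n>2k+1))
    (Power (Cycle n (n>2k+1⇒n≥3 n k k≥3 n>2k+1)) k)
theorem5 n k _ k-odd k≥3 n>2k+1 =
  pet→cycle^k n k (k≥3⇒2<2k k k≥3) (n>2k+1⇒2k≤n n k n>2k+1) (n>2k+1⇒n≥3 n k k≥3 n>2k+1) k-odd
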